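{- Let $\mathbf P=(P,\leq)$ be a partially ordered set with maximum $1$ and suppose that $a \in P$ is a $1$-compact element of $\mathbf P$, or just that $a$ is very-weakly-$1$-compact. Then $a$ is a non-generator if and only if $a \leq p$ for every maximal$_{<1}$ element $p$ of $\mathbf P$.
   Context: Let $\mathbf P=(P,\leq)$ be a poset with maximum $1$ (not assumed to be a semilattice). For $a,e \in P$, "$a \vee e = 1$" means that there is no $p \in P$ such that $p<1$, $a \leq p$ and $e \leq p$. For $X\subseteq P$, "$\bigvee X=1$" means that there is no $p\in P$ such that $p<1$ and $x\leq p$ for every $x\in X$. An element $a\in P$ is a non-generator if, for every $e \in P$, $a\vee e=1$ implies $e=1$. An element $p\in P$ is maximal$_{<1}$ if $p<1$ and there is no $q \in P$ such that $p<q<1$. An element $e\in P$ can be extended to a maximal$_{<1}$ element if there is a maximal$_{<1}$ element $p$ with $e \leq p$. A chain is a nonempty subset that is linearly ordered by the induced order; chains are denoted as families $(e_i)_{i\in I}$. An element $a$ is $1$-compact if, whenever $(e_i)_{i\in I}$ is a chain of elements of $P$ and $\bigvee_{i\in I}e_i=1$, then $a\leq e_i$ for some $i \in I$. An element $a$ is very-weakly-$1$-compact if, whenever $(e_i)_{i\in I}$ is a chain of elements of $P$ with $e_i<1$ for every $i\in I$, $\bigvee_{i\in I}e_i=1$, and no $e_i$ can be extended to a maximal$_{<1}$ element, then there are some $i\in I$ and some $r\in P$ such that $r<1$, $e_i\leq r$ and $a\leq r$. -}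

module Defs where

open import Level using (Level; _⊔_; suc)
open import Data.Product using (∃; _×_)
open import Data.Sum using (_⊎_)
open import Relation.Nullary using (¬_)
open import Relation.Unary using (Pred; _∈_; Satisfiable)
open import Relation.Binary.Bundles using (Poset)
open import Relation.Binary.Definitions using (Maximum)

-- The level ℓ is that of the subsets of P (predicates on the carrier) over
-- which chains range; under excluded middle its choice is immaterial.  Subsets
-- need not respect _≈_: closing one under _≈_ changes neither its upper bounds
-- nor whether it is a chain.
module Generation {c ℓ₁ ℓ₂ : Level} (P : Poset c ℓ₁ ℓ₂) (ℓ : Level)
                  (𝟏 : Poset.Carrier P)
                  (𝟏-maximum : Maximum (Poset._≤_ P) 𝟏) where

  open Poset P using (Carrier; _≈_; _≤_)
  open import Relation.Binary.Properties.Poset P using (_<_)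

  -- P need not be a join semilattice: no join operation is involved here.
  _∨_≡𝟏 : Carrier → Carrier → Set (c ⊔ ℓ₁ ⊔ ℓ₂)
  a ∨ e ≡𝟏 = ¬ ∃ λ p → p < 𝟏 × a ≤ p × e ≤ p

  ⋁_≡𝟏 : Pred Carrier ℓ → Set (c ⊔ ℓ₁ ⊔ ℓ₂ ⊔ ℓ)
  ⋁ X ≡𝟏 = ¬ ∃ λ p → p < 𝟏 × (∀ x → x ∈ X → x ≤ p)

  NonGenerator : Carrier → Set (c ⊔ ℓ₁ ⊔ ℓ₂)
  NonGenerator a = ∀ e → a ∨ e ≡𝟏 → e ≈ 𝟏

  Maximal<𝟏 : Carrier → Set (c ⊔ ℓ₁ ⊔ ℓ₂)
  Maximal<𝟏 p = p < 𝟏 × ¬ (∃ λ q → p < q × q < 𝟏)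

  ExtendsToMaximal<𝟏 : Carrier → Set (c ⊔ ℓ₁ ⊔ ℓ₂)
  ExtendsToMaximal<𝟏 e = ∃ λ p → Maximal<𝟏 p × e ≤ p

  Chain : Pred Carrier ℓ → Set (c ⊔ ℓ₂ ⊔ ℓ)
  Chain E = Satisfiable E × (∀ x y → x ∈ E → y ∈ E → x ≤ y ⊎ y ≤ x)

  𝟏-Compact : Carrier → Set (c ⊔ ℓ₁ ⊔ ℓ₂ ⊔ suc ℓ)
  𝟏-Compact a = ∀ (E : Pred Carrier ℓ) → Chain E → ⋁ E ≡𝟏 →
                ∃ λ e → e ∈ E × a ≤ e

  VeryWeakly-𝟏-Compact : Carrier → Set (c ⊔ ℓ₁ ⊔ ℓ₂ ⊔ suc ℓ)
  VeryWeakly-𝟏-Compact a =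
    ∀ (E : Pred Carrier ℓ) → Chain E →
    (∀ e → e ∈ E → e < 𝟏) →
    ⋁ E ≡𝟏 →
    (∀ e → e ∈ E → ¬ ExtendsToMaximal<𝟏 e) →
    ∃ λ e → e ∈ E × (∃ λ r → r < 𝟏 × e ≤ r × a ≤ r)

{-# OPTIONS --safe #-}

-- If a lies below every maximal<𝟏 element and a ∨ e ≡𝟏 with e < 𝟏, then e does
-- not extend to a maximal<𝟏 element, so the interval [e , 𝟏) has no maximal
-- element in it.  By Hausdorff's maximal principle [e , 𝟏) contains a chain
-- without strict upper bound there; its join is then 𝟏, and compactness of a
-- yields an element r < 𝟏 above both e and a, contradicting a ∨ e ≡𝟏.
--
-- Excluded middle is assumed for all types, hence selects elements of inhabited
-- types; this is the choice that Hausdorff's principle needs.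
module Submission where

open import Defs
open import Level using (Level; _⊔_; Lift; lift; lower)
open import Data.Bool using (Bool; T)
open import Data.Bool.Properties using (⇔→≡; T-≡)
open import Data.Empty using (⊥-elim)
open import Data.Maybe using (Maybe; just)
open import Data.Maybe.Properties using (just-injective)
open import Data.Product using (∃; _×_; _,_; proj₁; proj₂)
open import Data.Sum using (_⊎_; inj₁; inj₂; [_,_]′)
open import Function.Base using (_∘_; id)
open import Function.Bundles using (_⇔_; mk⇔; Equivalence)
open import Relation.Binary.Bundles using (Poset)
open import Relation.Binary.Core using (Rel)
open import Relation.Binary.Definitions using (Maximum; Irreflexive)
open import Relation.Binary.PropositionalEquality using (_≡_; refl; sym; trans; cong)
open import Relation.Nullary using (¬_; yes; no)
open import Relation.Nullary.Decidable using (⌊_⌋; toWitness; fromWitness; decidable-stable; dec⇒maybe)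
open import Relation.Unary using (Pred)
open import Axiom.ExcludedMiddle using (ExcludedMiddle)
open import Axiom.Extensionality.Propositional using (Extensionality)

module Classical (em : ∀ {i : Level} → ExcludedMiddle i)
                 (ext : ∀ {i j : Level} → Extensionality i j) where

  by-contradiction : ∀ {p} {P : Set p} → ¬ ¬ P → P
  by-contradiction = decidable-stable em

  -- Subsets are Bool-valued so that they are extensional and do not raise the
  -- universe level.
  Subset : ∀ {a} → Set a → Set a
  Subset A = A → Bool

  ⟦_⟧ : ∀ {a p} {A : Set a} → Pred A p → Subset A
  ⟦ P ⟧ x = ⌊ em {P = P x} ⌋

  infix 4 _∈_ _⊆_

  _∈_ : ∀ {a} {A : Set a} → A → Subset A → Set
  x ∈ C = T (C x)

  _⊆_ : ∀ {a} {A : Set a} → Rel (Subset A) a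
  C ⊆ D = ∀ {x} → x ∈ C → x ∈ D

  ⊆-antisym : ∀ {a} {A : Set a} {C D : Subset A} → C ⊆ D → D ⊆ C → C ≡ D
  ⊆-antisym C⊆D D⊆C = ext λ _ → ⇔→≡
    (mk⇔ (to T-≡ ∘ C⊆D ∘ from T-≡) (to T-≡ ∘ D⊆C ∘ from T-≡))
    where open Equivalence

  module Hausdorff {a r} {A : Set a} (_≺_ : Rel A r) where

    StrictUpperBound : Subset A → Pred A (a ⊔ r)
    StrictUpperBound C b = ∀ x → x ∈ C → x ≺ b

    Connected : Subset A → Set (a ⊔ r)
    Connected C = ∀ {x y} → x ∈ C → y ∈ C → x ≺ y ⊎ x ≡ y ⊎ y ≺ x

    bound : (C : Subset A) → Maybe (∃ (StrictUpperBound C))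
    bound C = dec⇒maybe em

    -- The graph of the choice made by `bound`: one selected bound per subset, so that `extend` adds
    -- at most one element, and none to a subset without strict upper bound.
    IsBound : Subset A → Pred A (a ⊔ r)
    IsBound C b = ∃ λ (C≺b : StrictUpperBound C b) → bound C ≡ just (b , C≺b)

    isBound-unique : ∀ {C x y} → IsBound C x → IsBound C y → x ≡ y
    isBound-unique (_ , p) (_ , q) = cong proj₁ (just-injective (trans (sym p) q))

    isBound-exists : ∀ C → ∃ (StrictUpperBound C) → ∃ (IsBound C)
    isBound-exists C b with em {P = ∃ (StrictUpperBound C)}
    ... | yes (b′ , C≺b′) = b′ , C≺b′ , refl
    ... | no ¬b           = ⊥-elim (¬b b)

    extend : Subset A → Subset A
    extend C = ⟦ (λ x → x ∈ C ⊎ IsBound C x) ⟧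

    ⋃ : Subset (Subset A) → Subset A
    ⋃ 𝒮 = ⟦ (λ x → ∃ λ C → C ∈ 𝒮 × x ∈ C) ⟧

    -- Zermelo's tower, generated without transfinite recursion; it starts at the empty subset, the
    -- `union` of the empty family.
    data Tower : Pred (Subset A) a where
      step  : ∀ {C} → Tower C → Tower (extend C)
      union : ∀ 𝒮 → (∀ {C} → C ∈ 𝒮 → Tower C) → Tower (⋃ 𝒮)

    ⊆-extend : ∀ C → C ⊆ extend C
    ⊆-extend C = fromWitness ∘ inj₁

    ⊆-⋃ : ∀ {𝒮 C} → C ∈ 𝒮 → C ⊆ ⋃ 𝒮
    ⊆-⋃ C∈𝒮 x∈C = fromWitness (_ , C∈𝒮 , x∈C)

    -- Induction on both derivations at once; the recursive call with the roles exchanged still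
    -- shrinks the pair.
    compare : ∀ {C D} → Tower C → Tower D → D ⊆ C ⊎ extend C ⊆ D
    compare {C} t (step {D} u) with compare t u
    ... | inj₂ C⁺⊆D = inj₂ (⊆-extend D ∘ C⁺⊆D)
    ... | inj₁ D⊆C with compare u t
    ...   | inj₂ D⁺⊆C = inj₁ D⁺⊆C
    -- Equal subsets have the same chosen bound, hence the same extension; this is where
    -- extensionality enters.
    ...   | inj₁ C⊆D with ⊆-antisym {C = C} C⊆D D⊆C
    ...     | refl = inj₂ id
    compare {C} t (union 𝒮 u)
      with em {P = ∃ λ D → D ∈ 𝒮 × extend C ⊆ D}
    ... | yes (D , D∈𝒮 , C⁺⊆D) = inj₂ (⊆-⋃ {C = D} D∈𝒮 ∘ C⁺⊆D)
    ... | no ¬above = inj₁ λ x∈⋃ → let (_ , D∈𝒮 , x∈D) = toWitness x∈⋃ in below D∈𝒮 x∈D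
      where
      below : ∀ {D} → D ∈ 𝒮 → D ⊆ C
      below D∈𝒮 with compare t (u D∈𝒮)
      ... | inj₁ D⊆C  = D⊆C
      ... | inj₂ C⁺⊆D = ⊥-elim (¬above (_ , D∈𝒮 , C⁺⊆D))

    -- A new element lies strictly above all old ones; in a union, `compare` places both elements in
    -- a single member of the family.
    tower-connected : ∀ {C} → Tower C → Connected C
    tower-connected (step t) x∈ y∈ with toWitness x∈ | toWitness y∈
    ... | inj₁ x∈C       | inj₁ y∈C       = tower-connected t x∈C y∈C
    ... | inj₁ x∈C       | inj₂ (C≺y , _) = inj₁ (C≺y _ x∈C)
    ... | inj₂ (C≺x , _) | inj₁ y∈C       = inj₂ (inj₂ (C≺x _ y∈C))
    ... | inj₂ x-bound   | inj₂ y-bound   = inj₂ (inj₁ (isBound-unique x-bound y-bound))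
    tower-connected (union 𝒮 t) x∈ y∈ with toWitness x∈ | toWitness y∈
    ... | C , C∈𝒮 , x∈C | D , D∈𝒮 , y∈D with compare (t C∈𝒮) (t D∈𝒮)
    ...   | inj₁ D⊆C  = tower-connected (t C∈𝒮) x∈C (D⊆C y∈D)
    ...   | inj₂ C⁺⊆D = tower-connected (t D∈𝒮) (C⁺⊆D (⊆-extend C x∈C)) y∈D

    -- The union `M` of the whole tower belongs to the tower, and so does `extend M`. Hence
    -- `extend M` is contained in `M`, and a chosen bound of `M` would lie strictly above itself.
    hausdorff : Irreflexive _≡_ _≺_ →
                ∃ λ C → Connected C × ¬ ∃ (StrictUpperBound C)
    hausdorff irrefl = M , tower-connected M-tower , M-unbounded
      where
      M : Subset A
      M = ⋃ ⟦ Tower ⟧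

      M-tower : Tower M
      M-tower = union ⟦ Tower ⟧ toWitness

      M-unbounded : ¬ ∃ (StrictUpperBound M)
      M-unbounded bounded = let (b , M≺b , eq) = isBound-exists M bounded in
        irrefl refl (M≺b b (⊆-⋃ {C = extend M} (fromWitness (step M-tower))
                                (fromWitness (inj₂ (M≺b , eq)))))

  module _ {c ℓ₁ ℓ₂} (P : Poset c ℓ₁ ℓ₂) (ℓ : Level) (𝟏 : Poset.Carrier P)
           (𝟏-maximum : Maximum (Poset._≤_ P) 𝟏) where

    open Poset P using (Carrier; _≈_; _≤_; antisym; module Eq)
      renaming (refl to ≤-refl; trans to ≤-trans; reflexive to ≤-reflexive)
    open import Relation.Binary.Properties.Poset P using (_<_; <-irrefl)
    open Generation P ℓ 𝟏 𝟏-maximum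

    ≤-<-trans : ∀ {x y z} → x ≤ y → y < z → x < z
    ≤-<-trans x≤y (y≤z , y≉z) = ≤-trans x≤y y≤z ,
      λ x≈z → y≉z (antisym y≤z (≤-trans (≤-reflexive (Eq.sym x≈z)) x≤y))

    -- If `a` is not below `p`, a common upper bound of both that is less than `𝟏` would lie
    -- strictly between `p` and `𝟏`; so `a ∨ p ≡𝟏`, which forces `p ≈ 𝟏`.
    nonGenerator⇒≤maximal : ∀ {a} → NonGenerator a → ∀ p → Maximal<𝟏 p → a ≤ p
    nonGenerator⇒≤maximal a-nongen p ((p≤𝟏 , p≉𝟏) , p-max) =
      by-contradiction λ a≰p → p≉𝟏 (a-nongen p λ (q , q<𝟏 , a≤q , p≤q) →
        p-max (q , (p≤q , λ p≈q → a≰p (≤-trans a≤q (≤-reflexive (Eq.sym p≈q)))) , q<𝟏))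

    Cofinal<𝟏ChainAbove : Carrier → Pred Carrier ℓ → Set _
    Cofinal<𝟏ChainAbove e E =
      Chain E × (∀ x → E x → e ≤ x × x < 𝟏) × ⋁ E ≡𝟏

    cofinalChain : ∀ {e} → e < 𝟏 → ¬ ExtendsToMaximal<𝟏 e → ∃ (Cofinal<𝟏ChainAbove e)
    cofinalChain {e} e<𝟏 e-nonext =
      E , (E-nonempty , E-total) , E-within , E-join
      where
      Interval : Set _
      Interval = ∃ λ x → e ≤ x × x < 𝟏

      open Hausdorff {A = Interval} (λ x y → proj₁ x < proj₁ y)

      maximalChain : ∃ λ C → Connected C × ¬ ∃ (StrictUpperBound C)
      maximalChain = hausdorff λ { refl → <-irrefl Eq.refl }

      C : Subset Interval
      C = proj₁ maximalChain

      -- Passing through a Bool-valued subset brings the image of `C` down to the lowest level, from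
      -- which it lifts to any `ℓ`.
      E : Pred Carrier ℓ
      E x = Lift ℓ (x ∈ ⟦ (λ x → ∃ λ i → i ∈ C × proj₁ i ≡ x) ⟧)

      member : ∀ {i} → i ∈ C → E (proj₁ i)
      member i∈C = lift (fromWitness (_ , i∈C , refl))

      preimage : ∀ {x} → E x → ∃ λ i → i ∈ C × proj₁ i ≡ x
      preimage = toWitness ∘ lower

      E-within : ∀ x → E x → e ≤ x × x < 𝟏
      E-within x x∈E with preimage x∈E
      ... | (_ , within) , _ , refl = within

      E-nonempty : ∃ E
      -- Were the chain empty, `e` would be a strict upper bound of it vacuously.
      E-nonempty = by-contradiction λ empty →
        proj₂ (proj₂ maximalChain)
          ((e , ≤-refl , e<𝟏) , λ _ i∈C → ⊥-elim (empty (_ , member i∈C)))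

      E-total : ∀ x y → E x → E y → x ≤ y ⊎ y ≤ x
      E-total x y x∈E y∈E with preimage x∈E | preimage y∈E
      ... | _ , i∈C , refl | _ , j∈C , refl with proj₁ (proj₂ maximalChain) i∈C j∈C
      ...   | inj₁ (x≤y , _)        = inj₁ x≤y
      ...   | inj₂ (inj₁ refl)      = inj₁ ≤-refl
      ...   | inj₂ (inj₂ (y≤x , _)) = inj₂ y≤x

      -- An upper bound `p` below `𝟏` would be a maximal element above `e`, since any `q` strictly
      -- between `p` and `𝟏` would strictly bound `C` within the interval.
      E-join : ⋁ E ≡𝟏
      E-join (p , p<𝟏 , E≤p) = e-nonext (p , (p<𝟏 , p-max) , e≤p)
        where
        e≤p : e ≤ p
        e≤p = let (x , x∈E) = E-nonempty in
          ≤-trans (proj₁ (E-within x x∈E)) (E≤p x x∈E)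

        p-max : ¬ ∃ λ q → p < q × q < 𝟏
        p-max (q , p<q , q<𝟏) = proj₂ (proj₂ maximalChain)
          ((q , ≤-trans e≤p (proj₁ p<q) , q<𝟏) ,
           λ _ i∈C → ≤-<-trans (E≤p _ (member i∈C)) p<q)

    ≤maximal⇒nonGenerator : ∀ {a} → 𝟏-Compact a ⊎ VeryWeakly-𝟏-Compact a →
                            (∀ p → Maximal<𝟏 p → a ≤ p) → NonGenerator a
    ≤maximal⇒nonGenerator {a} a-compact a≤maximal e a∨e≡𝟏 =
      by-contradiction λ e≉𝟏 →
        let (E , E-chain , within , E-join) = cofinalChain (𝟏-maximum e , e≉𝟏) e-nonext
            (x , x∈E , r , r<𝟏 , x≤r , a≤r) = commonBound E E-chain within E-join a-compact
        in a∨e≡𝟏 (r , r<𝟏 , a≤r , ≤-trans (proj₁ (within x x∈E)) x≤r)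
      where
      e-nonext : ¬ ExtendsToMaximal<𝟏 e
      e-nonext (p , p-max , e≤p) = a∨e≡𝟏 (p , proj₁ p-max , a≤maximal p p-max , e≤p)

      -- For a `𝟏-Compact` element the chain member above `a` is itself the bound `r`; in the other
      -- case, members of `E` inherit non-extendability from `e` below them.
      commonBound : ∀ E → Chain E → (∀ x → E x → e ≤ x × x < 𝟏) → ⋁ E ≡𝟏 →
                    𝟏-Compact a ⊎ VeryWeakly-𝟏-Compact a →
                    ∃ λ x → E x × ∃ λ r → r < 𝟏 × x ≤ r × a ≤ r
      commonBound E E-chain within E-join (inj₁ compact) =
        let (x , x∈E , a≤x) = compact E E-chain E-join in
        x , x∈E , x , proj₂ (within x x∈E) , ≤-refl , a≤x
      commonBound E E-chain within E-join (inj₂ compact) =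
        compact E E-chain (λ x → proj₂ ∘ within x) E-join
          λ x x∈E (p , p-max , x≤p) →
            e-nonext (p , p-max , ≤-trans (proj₁ (within x x∈E)) x≤p)

corollary2p5 :
    (∀ {i : Level} → ExcludedMiddle i) →
    (∀ {i j : Level} → Extensionality i j) →
    ∀ {c ℓ₁ ℓ₂ ℓ : Level} (P : Poset c ℓ₁ ℓ₂)
      (𝟏 : Poset.Carrier P) (𝟏-maximum : Maximum (Poset._≤_ P) 𝟏)
      (a : Poset.Carrier P) →
    let open Poset P using (_≤_)
        open Generation P ℓ 𝟏 𝟏-maximum
    in 𝟏-Compact a ⊎ VeryWeakly-𝟏-Compact a →
       NonGenerator a ⇔ (∀ p → Maximal<𝟏 p → a ≤ p)
corollary2p5 em ext {ℓ = ℓ} P 𝟏 𝟏-maximum a a-compact =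
  mk⇔ (nonGenerator⇒≤maximal P ℓ 𝟏 𝟏-maximum)
      (≤maximal⇒nonGenerator P ℓ 𝟏 𝟏-maximum a-compact)
  where open Classical em ext
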